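{- Let $B=F(b_1,\ldots,b_n)$ be a Ferrers board with $0\le b_1\le\cdots\le b_n$ and $b_n>0$, and let $B^-=F(b_1,\ldots,b_{n-1})$. Then for all $1\le k\le n$, $$\mathbf{rPT}_k(B,p,q,r)=\mathbf{rPT}_k(B^-,p,q,r)+P_{b_{n-(k-1)}}(p,q,r)\,\mathbf{rPT}_{k-1}(B^-,p,q,r).$$
   Context: For $m\ge1$, a $P$-tiling of height $m$ is a tiling of a column of height $m$ by tiles of heights 1, 2 and 3 whose bottom-most tile has height 1. $P_m(p,q,r)=\sum_T q^{\mathrm{one}(T)}p^{\mathrm{two}(T)}r^{\mathrm{three}(T)}$ over all $P$-tilings $T$ of height $m$, where $\mathrm{one},\mathrm{two},\mathrm{three}$ count tiles of height 1, 2, 3. There are no $P$-tilings of height 0 and $P_0(p,q,r)=0$. A Ferrers board $F(b_1,\ldots,b_n)$ has column heights $b_1,\ldots,b_n$ from left to right. A $P$-rook placement of $k$ tilings in $B=F(b_1,\ldots,b_n)$ is a choice of columns $1\le i_1<\cdots<i_k\le n$ with, for each $s=1,\ldots,k$, a $P$-tiling of height $b_{i_s-(s-1)}$ in column $i_s$ (the number of cells of column $i_s$ left uncanceled by the tilings in earlier columns, each tiling canceling top cells of columns to its right so that after $s$ tilings the untiled columns have $b_1,\ldots,b_{n-s}$ uncanceled cells). Its weight is $q^ap^br^c$ with $a,b,c$ the total numbers of tiles of height 1, 2, 3 used. $\mathbf{rPT}_k(B,p,q,r)$ is the sum of the weights of all $P$-rook placements of $k$ tilings in $B$ (the empty placement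 has weight 1; the sum is 0 if there are none). -}

module Defs where

open import Algebra.Bundles using (CommutativeSemiring)
open import Data.Empty using (⊥)
open import Data.Fin.Base using (Fin; toℕ; pred)
import Data.Fin.Base as Fin
import Data.Fin.Properties as Fin
open import Data.List.Base using (List; []; _∷_; [_]; _++_; map; foldr; concatMap; allFin)
open import Data.List.Membership.Propositional using (_∈_)
open import Data.List.Membership.Propositional.Properties
  using (∈-map⁺; ∈-map⁻; ∈-++⁺ˡ; ∈-++⁺ʳ; ∈-++⁻; ∈-allFin)
import Data.List.Relation.Unary.All as ListAll
open import Data.List.Relation.Unary.AllPairs using ([]; _∷_)
open import Data.List.Relation.Unary.Any using (here; there)
open import Data.List.Relation.Unary.Unique.Propositional using (Unique)
import Data.List.Relation.Unary.Unique.Propositional.Properties as Unique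
open import Data.Nat.Base using (ℕ; zero; suc; _+_)
open import Data.Product.Base using (Σ; Σ-syntax; _×_; _,_; proj₁)
open import Data.Sum.Base using (_⊎_; inj₁; inj₂)
open import Data.Sum.Properties using (inj₁-injective; inj₂-injective)
open import Data.Vec.Base using (Vec; []; _∷_; lookup; tabulate)
open import Data.Vec.Functional using (Vector)
open import Data.Vec.Relation.Unary.All using (All; []; _∷_)
open import Data.Vec.Relation.Unary.Linked using (Linked; linked?)
import Data.Vec.Relation.Unary.Linked as Linked
open import Function.Base using (_∘_)
open import Function.Bundles using (_↔_; mk↔ₛ′; Inverse)
open import Relation.Binary.PropositionalEquality
  using (_≡_; refl; sym; trans; cong; subst)
open import Relation.Nullary using (Dec; yes; no; Irrelevant; contradiction)

-- Duplicate-free, complete enumerations.  A sum over `elements` is thus the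
-- sum over all inhabitants of the type, each taken exactly once.

record Finite (A : Set) : Set where
  field
    elements : List A
    complete : ∀ x → x ∈ elements
    unique   : Unique elements

open Finite public

finite-Fin : ∀ n → Finite (Fin n)
finite-Fin n = record
  { elements = allFin n
  ; complete = ∈-allFin
  ; unique   = Unique.allFin⁺ n
  }

finite-irrelevant : ∀ {A : Set} → Irrelevant A → Dec A → Finite A
finite-irrelevant irr (yes a) = record
  { elements = [ a ]
  ; complete = λ x → here (irr x a)
  ; unique   = ListAll.[] ∷ []
  }
finite-irrelevant irr (no ¬a) = record
  { elements = []
  ; complete = λ x → contradiction x ¬a
  ; unique   = []
  }

finite-↔ : ∀ {A B : Set} → A ↔ B → Finite A → Finite B
finite-↔ A↔B E = record
  { elements = map to (elements E)
  ; complete = λ y → subst (_∈ map to (elements E)) (strictlyInverseˡ y)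
                       (∈-map⁺ to (complete E (from y)))
  ; unique   = Unique.map⁺ to-injective (unique E)
  }
  where
  open Inverse A↔B
  to-injective : ∀ {x y} → to x ≡ to y → x ≡ y
  to-injective {x} {y} eq =
    trans (sym (strictlyInverseʳ x)) (trans (cong from eq) (strictlyInverseʳ y))

finite-⊎ : ∀ {A B : Set} → Finite A → Finite B → Finite (A ⊎ B)
finite-⊎ {A} {B} E F = record
  { elements = map inj₁ (elements E) ++ map inj₂ (elements F)
  ; complete = λ where
      (inj₁ x) → ∈-++⁺ˡ (∈-map⁺ inj₁ (complete E x))
      (inj₂ y) → ∈-++⁺ʳ (map inj₁ (elements E)) (∈-map⁺ inj₂ (complete F y))
  ; unique   = Unique.++⁺ (Unique.map⁺ inj₁-injective (unique E))
                          (Unique.map⁺ inj₂-injective (unique F)) disjoint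
  }
  where
  disjoint : ∀ {z} → z ∈ map inj₁ (elements E) × z ∈ map inj₂ (elements F) → ⊥
  disjoint (p , q) with ∈-map⁻ inj₁ p | ∈-map⁻ inj₂ q
  ... | _ , _ , refl | _ , _ , ()

finite-Σ : ∀ {A : Set} {B : A → Set} →
           Finite A → (∀ x → Finite (B x)) → Finite (Σ A B)
finite-Σ {A} {B} E F = record
  { elements = pairs (elements E)
  ; complete = λ (x , y) → pairs-complete (complete E x) y
  ; unique   = pairs-unique (unique E)
  }
  where
  pairs : List A → List (Σ A B)
  pairs = concatMap (λ x → map (x ,_) (elements (F x)))

  pairs-complete : ∀ {x xs} → x ∈ xs → ∀ y → (x , y) ∈ pairs xs
  pairs-complete {x} (here refl) y = ∈-++⁺ˡ (∈-map⁺ (x ,_) (complete (F x) y))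
  pairs-complete (there {x′} x∈xs) y =
    ∈-++⁺ʳ (map (x′ ,_) (elements (F x′))) (pairs-complete x∈xs y)

  pairs-sound : ∀ xs {z} → z ∈ pairs xs → proj₁ z ∈ xs
  pairs-sound (x ∷ xs) z∈ with ∈-++⁻ (map (x ,_) (elements (F x))) z∈
  ... | inj₂ z∈′ = there (pairs-sound xs z∈′)
  ... | inj₁ z∈′ with ∈-map⁻ (x ,_) z∈′
  ...   | _ , _ , refl = here refl

  pairs-unique : ∀ {xs} → Unique xs → Unique (pairs xs)
  pairs-unique [] = []
  pairs-unique {x ∷ xs} (x∉xs ∷ uniq) =
    Unique.++⁺ (Unique.map⁺ (λ { refl → refl }) (unique (F x)))
               (pairs-unique uniq) disjoint
    where
    disjoint : ∀ {z} → z ∈ map (x ,_) (elements (F x)) × z ∈ pairs xs → ⊥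
    disjoint (p , q) with ∈-map⁻ (x ,_) p
    ... | _ , _ , refl = ListAll.lookup x∉xs (pairs-sound xs q) refl

finite-Vec : ∀ {A : Set} → Finite A → ∀ k → Finite (Vec A k)
finite-Vec E zero    = finite-irrelevant (λ { [] [] → refl }) (yes [])
finite-Vec E (suc k) = finite-↔
  (mk↔ₛ′ (λ (x , xs) → x ∷ xs) (λ { (x ∷ xs) → x , xs })
         (λ { (_ ∷ _) → refl }) (λ { (_ , _) → refl }))
  (finite-Σ E (λ _ → finite-Vec E k))

finite-All : ∀ {A : Set} {P : A → Set} → (∀ x → Finite (P x)) →
             ∀ {k} (xs : Vec A k) → Finite (All P xs)
finite-All E []       = finite-irrelevant (λ { [] [] → refl }) (yes [])
finite-All E (x ∷ xs) = finite-↔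
  (mk↔ₛ′ (λ (p , ps) → p ∷ ps) (λ { (p ∷ ps) → p , ps })
         (λ { (_ ∷ _) → refl }) (λ { (_ , _) → refl }))
  (finite-Σ (E x) (λ _ → finite-All E xs))

-- Tilings are listed from the bottom tile upwards.

data Tiling : ℕ → Set where
  empty : Tiling 0
  tile₁ : ∀ {m} → Tiling m → Tiling (1 + m)
  tile₂ : ∀ {m} → Tiling m → Tiling (2 + m)
  tile₃ : ∀ {m} → Tiling m → Tiling (3 + m)

data PTiling : ℕ → Set where
  bottom₁ : ∀ {m} → Tiling m → PTiling (1 + m)

record Counts : Set where
  constructor counts
  field
    ones twos threes : ℕ

open Counts public

_⊕_ : Counts → Counts → Counts
counts a b c ⊕ counts a′ b′ c′ = counts (a + a′) (b + b′) (c + c′)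

tilingCounts : ∀ {m} → Tiling m → Counts
tilingCounts empty     = counts 0 0 0
tilingCounts (tile₁ T) = counts 1 0 0 ⊕ tilingCounts T
tilingCounts (tile₂ T) = counts 0 1 0 ⊕ tilingCounts T
tilingCounts (tile₃ T) = counts 0 0 1 ⊕ tilingCounts T

pTilingCounts : ∀ {m} → PTiling m → Counts
pTilingCounts (bottom₁ T) = counts 1 0 0 ⊕ tilingCounts T

finite-Tiling : ∀ m → Finite (Tiling m)
finite-Tiling 0 = finite-irrelevant (λ { empty empty → refl }) (yes empty)
finite-Tiling 1 = finite-↔
  (mk↔ₛ′ tile₁ (λ { (tile₁ T) → T }) (λ { (tile₁ _) → refl }) (λ _ → refl))
  (finite-Tiling 0)
finite-Tiling 2 = finite-↔
  (mk↔ₛ′ (λ { (inj₁ T) → tile₁ T ; (inj₂ T) → tile₂ T })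
         (λ { (tile₁ T) → inj₁ T ; (tile₂ T) → inj₂ T })
         (λ { (tile₁ _) → refl ; (tile₂ _) → refl })
         (λ { (inj₁ _) → refl ; (inj₂ _) → refl }))
  (finite-⊎ (finite-Tiling 1) (finite-Tiling 0))
finite-Tiling (suc (suc (suc m))) = finite-↔
  (mk↔ₛ′ (λ { (inj₁ T) → tile₁ T ; (inj₂ (inj₁ T)) → tile₂ T
            ; (inj₂ (inj₂ T)) → tile₃ T })
         (λ { (tile₁ T) → inj₁ T ; (tile₂ T) → inj₂ (inj₁ T)
            ; (tile₃ T) → inj₂ (inj₂ T) })
         (λ { (tile₁ _) → refl ; (tile₂ _) → refl ; (tile₃ _) → refl })
         (λ { (inj₁ _) → refl ; (inj₂ (inj₁ _)) → refl
            ; (inj₂ (inj₂ _)) → refl }))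
  (finite-⊎ (finite-Tiling (suc (suc m)))
    (finite-⊎ (finite-Tiling (suc m)) (finite-Tiling m)))

finite-PTiling : ∀ m → Finite (PTiling m)
finite-PTiling zero    = finite-irrelevant (λ ()) (no λ ())
finite-PTiling (suc m) = finite-↔
  (mk↔ₛ′ bottom₁ (λ { (bottom₁ T) → T }) (λ { (bottom₁ _) → refl }) (λ _ → refl))
  (finite-Tiling m)

-- The column d places to the left of column i.  It saturates at the leftmost
-- column, but below it is only used where d ≤ toℕ i.

_⊖_ : ∀ {n} → Fin n → ℕ → Fin n
i ⊖ zero  = i
i ⊖ suc d = pred i ⊖ d

-- A board F(b₁,…,bₙ) is its vector of column heights.  Columns and the
-- positions s are both indexed from 0, so the 1-based b_{i_s - (s - 1)}
-- becomes b (i_s ⊖ s).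

uncanceled : ∀ {n k} → Vector ℕ n → Vec (Fin n) k → Vec ℕ k
uncanceled b is = tabulate λ s → b (lookup is s ⊖ toℕ s)

Placement : ∀ {n} → ℕ → Vector ℕ n → Set
Placement {n} k b =
  Σ[ is ∈ Vec (Fin n) k ] (Linked Fin._<_ is × All PTiling (uncanceled b is))

allCounts : ∀ {k} {hs : Vec ℕ k} → All PTiling hs → Counts
allCounts []       = counts 0 0 0
allCounts (T ∷ Ts) = pTilingCounts T ⊕ allCounts Ts

placementCounts : ∀ {n k} {b : Vector ℕ n} → Placement k b → Counts
placementCounts (_ , _ , Ts) = allCounts Ts

finite-Placement : ∀ {n} k (b : Vector ℕ n) → Finite (Placement k b)
finite-Placement {n} k b =
  finite-Σ (finite-Vec (finite-Fin n) k) λ is →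
  finite-Σ (finite-irrelevant (Linked.irrelevant Fin.<-irrelevant)
                              (linked? Fin._<?_ is)) λ _ →
  finite-All finite-PTiling (uncanceled b is)

-- An identity of polynomials in p, q, r with integer coefficients is the same
-- as an identity holding for all p, q, r in every commutative semiring, as
-- both sides have coefficients in ℕ.

module _ {c ℓ} (R : CommutativeSemiring c ℓ) where
  open CommutativeSemiring R using (Carrier; 0#; _*_; semiring)
    renaming (_+_ to _+ᴿ_)
  open import Algebra.Properties.Semiring.Exp semiring using (_^_)

  sum : ∀ {A : Set} → Finite A → (A → Carrier) → Carrier
  sum E f = foldr _+ᴿ_ 0# (map f (elements E))

  module _ (p q r : Carrier) where

    weight : Counts → Carrier
    weight w = q ^ ones w * p ^ twos w * r ^ threes w

    P : ℕ → Carrier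
    P m = sum (finite-PTiling m) (weight ∘ pTilingCounts)

    rPT : ∀ {n} → ℕ → Vector ℕ n → Carrier
    rPT k b = sum (finite-Placement k b) (weight ∘ placementCounts {b = b})

{-# OPTIONS --safe #-}
-- Once the tilings of a fixed column choice i₁ < ⋯ < i_k are summed out, rPT is
-- the sum over increasing column choices of ∏ₛ P(b (i_s ⊖ s)).  An increasing
-- choice of k columns among n + 1 either avoids the last column, or consists of
-- k - 1 earlier columns followed by the last one; the latter sits at position
-- k - 1 and contributes the factor P(b (n ⊖ (k - 1))).
module Submission where

open import Defs
open import Algebra.Bundles using (CommutativeSemiring)
import Algebra.Properties.CommutativeSemigroup as CommutativeSemigroupProperties
import Algebra.Properties.Semiring.Exp as Exp
open import Data.Fin.Base using (Fin; zero; suc; fromℕ; inject₁; toℕ)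
  renaming (_≤_ to _≤ᶠ_; _<_ to _<ᶠ_)
import Data.Fin.Properties as Fin
import Data.Fin.Relation.Unary.Top as Top
open import Data.List.Base using (List; []; _∷_; _++_; map; foldr; concatMap)
open import Data.List.Membership.Propositional using (_∈_)
open import Data.List.Membership.Propositional.Properties using (∈-map⁺)
open import Data.List.Membership.Propositional.Properties.WithK using (unique∧set⇒bag)
open import Data.List.Properties using (map-∘)
open import Data.List.Relation.Binary.BagAndSetEquality using (∼bag⇒↭)
open import Data.List.Relation.Binary.Permutation.Propositional
  using (_↭_; ↭⇒↭ₛ′)
import Data.List.Relation.Binary.Permutation.Propositional.Properties as Perm
import Data.List.Relation.Binary.Permutation.Setoid.Properties as PermSetoid
import Data.List.Relation.Unary.Unique.Propositional.Properties as Unique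
open import Data.Nat.Base using (ℕ; zero; suc; _≤_; _<_; _∸_)
import Data.Nat.Properties as ℕ
open import Data.Product.Base using (Σ-syntax; ∃-syntax; _,_)
open import Data.Sum.Base using (_⊎_; inj₁; inj₂)
open import Data.Vec.Base as Vec using (Vec; []; _∷_; _∷ʳ_; lookup; tabulate)
open import Data.Vec.Functional using (Vector; init; last)
open import Data.Vec.Properties
  using (∷-injective; ∷ʳ-injectiveˡ; lookup-map; tabulate-cong)
open import Data.Vec.Relation.Unary.All using (All; []; _∷_)
open import Data.Vec.Relation.Unary.Linked as Linked using (Linked; []; [-]; _∷_)
import Data.Vec.Relation.Unary.Linked.Properties as Linked
open import Function.Base using (_∘_)
open import Function.Bundles using (mk⇔)
open import Function.Definitions using (Injective)
open import Relation.Binary.PropositionalEquality as ≡ using (_≡_; _≢_)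
import Relation.Binary.Reasoning.Setoid as SetoidReasoning
open import Relation.Nullary using (contradiction)

-- Increasing column choices and their embedding into a longer board.

Increasing : ℕ → ℕ → Set
Increasing n k = Σ[ is ∈ Vec (Fin n) k ] Linked _<ᶠ_ is

finite-Linked : ∀ {n k} (is : Vec (Fin n) k) → Finite (Linked _<ᶠ_ is)
finite-Linked is = finite-irrelevant (Linked.irrelevant Fin.<-irrelevant)
                                     (Linked.linked? Fin._<?_ is)

finite-Increasing : ∀ n k → Finite (Increasing n k)
finite-Increasing n k = finite-Σ (finite-Vec (finite-Fin n) k) finite-Linked

-- `Linked _<ᶠ_` is proof-irrelevant, so the order proofs cannot tell two choices apart.
Increasing-≡ : ∀ {n k} {(is , l) (js , m) : Increasing n k} →
               is ≡ js → (is , l) ≡ (js , m)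
Increasing-≡ ≡.refl = ≡.cong (_ ,_) (Linked.irrelevant Fin.<-irrelevant _ _)

map-injective : ∀ {A B : Set} {f : A → B} {k} → Injective _≡_ _≡_ f →
                {xs ys : Vec A k} → Vec.map f xs ≡ Vec.map f ys → xs ≡ ys
map-injective f-inj {[]}     {[]}     _ = ≡.refl
map-injective f-inj {x ∷ xs} {y ∷ ys} eq with ∷-injective eq
... | p , q = ≡.cong₂ _∷_ (f-inj p) (map-injective f-inj q)

inject₁-mono-< : ∀ {n} {i j : Fin n} → i <ᶠ j → inject₁ i <ᶠ inject₁ j
inject₁-mono-< {i = i} {j} =
  ≡.subst₂ _<_ (≡.sym (Fin.toℕ-inject₁ i)) (≡.sym (Fin.toℕ-inject₁ j))

inject₁-cancel-< : ∀ {n} {i j : Fin n} → inject₁ i <ᶠ inject₁ j → i <ᶠ j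
inject₁-cancel-< {i = i} {j} =
  ≡.subst₂ _<_ (Fin.toℕ-inject₁ i) (Fin.toℕ-inject₁ j)

inject₁<fromℕ : ∀ {n} (i : Fin n) → inject₁ i <ᶠ fromℕ n
inject₁<fromℕ {n} i =
  ≡.subst (toℕ (inject₁ i) <_) (≡.sym (Fin.toℕ-fromℕ n)) (Fin.inject₁ℕ< i)

<⇒≢fromℕ : ∀ {n} {i j : Fin (suc n)} → i <ᶠ j → i ≢ fromℕ n
<⇒≢fromℕ {j = j} i<j ≡.refl = ℕ.<⇒≱ i<j (Fin.≤fromℕ j)

Linked-inject₁⁺ : ∀ {n k} {is : Vec (Fin n) k} →
                  Linked _<ᶠ_ is → Linked _<ᶠ_ (Vec.map inject₁ is)
Linked-inject₁⁺ = Linked.map⁺ ∘ Linked.map inject₁-mono-<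

Linked-inject₁⁻ : ∀ {n k} {is : Vec (Fin n) k} →
                  Linked _<ᶠ_ (Vec.map inject₁ is) → Linked _<ᶠ_ is
Linked-inject₁⁻ = Linked.map inject₁-cancel-< ∘ Linked.map⁻

-- `Linked` compares neighbours only, so the only possible new comparison is at the end, where every
-- `inject₁ i` lies below `fromℕ n`.
Linked-∷ʳ-fromℕ⁺ : ∀ {n k} {is : Vec (Fin n) k} → Linked _<ᶠ_ is →
                   Linked _<ᶠ_ (Vec.map inject₁ is ∷ʳ fromℕ n)
Linked-∷ʳ-fromℕ⁺ []                  = [-]
Linked-∷ʳ-fromℕ⁺ {is = i ∷ []} [-]   = inject₁<fromℕ i ∷ [-]
Linked-∷ʳ-fromℕ⁺ {is = _ ∷ _ ∷ _} (i<j ∷ l) =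
  inject₁-mono-< i<j ∷ Linked-∷ʳ-fromℕ⁺ l

Linked-∷ʳ-fromℕ⁻ : ∀ {n k} (is : Vec (Fin n) k) →
                   Linked _<ᶠ_ (Vec.map inject₁ is ∷ʳ fromℕ n) → Linked _<ᶠ_ is
Linked-∷ʳ-fromℕ⁻ []           _         = []
Linked-∷ʳ-fromℕ⁻ (_ ∷ [])     _         = [-]
Linked-∷ʳ-fromℕ⁻ (_ ∷ j ∷ is) (i<j ∷ l) =
  inject₁-cancel-< i<j ∷ Linked-∷ʳ-fromℕ⁻ (j ∷ is) l

-- Splitting column choices by whether they use the last column.

data LastColumn {n} : ∀ {k} → Vec (Fin (suc n)) (suc k) → Set where
  unused : ∀ {k} (js : Vec (Fin n) (suc k)) → LastColumn (Vec.map inject₁ js)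
  used   : ∀ {k} (js : Vec (Fin n) k) → LastColumn (Vec.map inject₁ js ∷ʳ fromℕ n)

lastColumn-∷ : ∀ {n k} {i : Fin (suc n)} {is : Vec (Fin (suc n)) (suc k)} →
               i ≢ fromℕ n → LastColumn is → LastColumn (i ∷ is)
lastColumn-∷ {i = i} i≢n v with Top.view i
... | Top.‵fromℕ = contradiction ≡.refl i≢n
lastColumn-∷ i≢n (unused js) | Top.‵inject₁ j = unused (j ∷ js)
lastColumn-∷ i≢n (used js)   | Top.‵inject₁ j = used (j ∷ js)

-- Every entry before the final one lies below its successor and so differs from `fromℕ n`; the
-- final entry alone decides the case.
lastColumn : ∀ {n k} {is : Vec (Fin (suc n)) (suc k)} →
             Linked _<ᶠ_ is → LastColumn is
lastColumn {is = i ∷ []} [-] with Top.view i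
... | Top.‵fromℕ     = used []
... | Top.‵inject₁ j = unused (j ∷ [])
lastColumn (i<j ∷ l) = lastColumn-∷ (<⇒≢fromℕ i<j) (lastColumn l)

-- The bijection behind Pascal's rule.
addColumn : ∀ {n k} → Increasing n (suc k) ⊎ Increasing n k →
            Increasing (suc n) (suc k)
addColumn (inj₁ (is , l)) = _ , Linked-inject₁⁺ l
addColumn (inj₂ (is , l)) = _ , Linked-∷ʳ-fromℕ⁺ l

-- Removing heads in step leaves two single columns, one in the image of `inject₁` and the other
-- `fromℕ n`.
map-inject₁≢∷ʳ-fromℕ : ∀ {n k} (is : Vec (Fin n) (suc k)) (js : Vec (Fin n) k) →
                       Vec.map inject₁ is ≢ Vec.map inject₁ js ∷ʳ fromℕ n
map-inject₁≢∷ʳ-fromℕ (i ∷ [])      []       eq with ∷-injective eq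
... | i≡n , _ = Fin.fromℕ≢inject₁ (≡.sym i≡n)
map-inject₁≢∷ʳ-fromℕ (_ ∷ i ∷ is) (_ ∷ js) eq with ∷-injective eq
... | _ , eq′ = map-inject₁≢∷ʳ-fromℕ (i ∷ is) js eq′

addColumn-injective : ∀ {n k} → Injective _≡_ _≡_ (addColumn {n} {k})
addColumn-injective {x = inj₁ _} {inj₁ _} eq =
  ≡.cong inj₁ (Increasing-≡ (map-injective Fin.inject₁-injective
                               (≡.cong (λ (is , _) → is) eq)))
addColumn-injective {x = inj₁ (is , _)} {inj₂ (js , _)} eq =
  contradiction (≡.cong (λ (is , _) → is) eq) (map-inject₁≢∷ʳ-fromℕ is js)
addColumn-injective {x = inj₂ (js , _)} {inj₁ (is , _)} eq =
  contradiction (≡.cong (λ (is , _) → is) (≡.sym eq)) (map-inject₁≢∷ʳ-fromℕ is js)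
addColumn-injective {x = inj₂ _} {inj₂ _} eq =
  ≡.cong inj₂ (Increasing-≡ (map-injective Fin.inject₁-injective
    (∷ʳ-injectiveˡ _ _ (≡.cong (λ (is , _) → is) eq))))

addColumn-surjective : ∀ {n k} (js : Increasing (suc n) (suc k)) →
                       ∃[ is ] addColumn is ≡ js
addColumn-surjective (_ , l) with lastColumn l
-- The rebuilt order proof need not be literally `l`, so the comparison goes through the columns.
... | unused js = inj₁ (js , Linked-inject₁⁻ l) , Increasing-≡ ≡.refl
... | used js   = inj₂ (js , Linked-∷ʳ-fromℕ⁻ js l) , Increasing-≡ ≡.refl

-- Uncanceled heights on the longer and the shorter board.

inject₁-⊖ : ∀ {n} (i : Fin n) d → inject₁ i ⊖ d ≡ inject₁ (i ⊖ d)
inject₁-⊖ i       zero    = ≡.refl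
-- `pred` saturates at the leftmost column on both boards alike.
inject₁-⊖ zero    (suc d) = inject₁-⊖ zero d
inject₁-⊖ (suc i) (suc d) = inject₁-⊖ (inject₁ i) d

-- Cancellation only shifts a column to the left, so the lookups from earlier columns never reach
-- the last one.
uncanceled-map-inject₁ : ∀ {n k} (b : Vector ℕ (suc n)) (is : Vec (Fin n) k) →
                         uncanceled b (Vec.map inject₁ is) ≡ uncanceled (init b) is
uncanceled-map-inject₁ b is = tabulate-cong λ s → ≡.cong b
  (≡.trans (≡.cong (_⊖ toℕ s) (lookup-map s inject₁ is))
           (inject₁-⊖ (lookup is s) (toℕ s)))

-- Here `f` takes the position as a natural number: the appended entry then gets position `k`, and
-- the induction can pass to `f ∘ suc`.
tabulate-lookup-∷ʳ : ∀ {A B : Set} {k} (f : ℕ → A → B) (xs : Vec A k) x →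
  tabulate (λ s → f (toℕ s) (lookup (xs ∷ʳ x) s)) ≡
  tabulate (λ s → f (toℕ s) (lookup xs s)) ∷ʳ f k x
tabulate-lookup-∷ʳ f []       x = ≡.refl
tabulate-lookup-∷ʳ f (_ ∷ xs) x = ≡.cong (_ ∷_) (tabulate-lookup-∷ʳ (f ∘ suc) xs x)

uncanceled-∷ʳ : ∀ {n k} (b : Vector ℕ n) (is : Vec (Fin n) k) i →
                uncanceled b (is ∷ʳ i) ≡ uncanceled b is ∷ʳ b (i ⊖ k)
uncanceled-∷ʳ b = tabulate-lookup-∷ʳ (λ s i → b (i ⊖ s))

-- Finite sums and their invariance under bijections.

elements-↭ : ∀ {A B : Set} (E : Finite A) (F : Finite B) {f : A → B} →
             Injective _≡_ _≡_ f → (∀ y → ∃[ x ] f x ≡ y) →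
             elements F ↭ map f (elements E)
elements-↭ E F {f} inj surj = ∼bag⇒↭
  -- Both lists are duplicate-free and contain every element of `B`, so they agree as bags.
  (unique∧set⇒bag (unique F) (Unique.map⁺ inj (unique E))
    (mk⇔ (λ _ → image _) (λ _ → complete F _)))
  where
  image : ∀ y → y ∈ map f (elements E)
  image y with surj y
  ... | x , ≡.refl = ∈-map⁺ f (complete E x)

module _ {c ℓ} (R : CommutativeSemiring c ℓ) where
  open CommutativeSemiring R
  open SetoidReasoning setoid

  private
    ∑ : ∀ {A : Set} → List A → (A → Carrier) → Carrier
    ∑ xs f = foldr _+_ 0# (map f xs)

  ∑-cong : ∀ {A : Set} {f g : A → Carrier} →
           (∀ x → f x ≈ g x) → ∀ xs → ∑ xs f ≈ ∑ xs g
  ∑-cong f≈g []       = refl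
  ∑-cong f≈g (x ∷ xs) = +-cong (f≈g x) (∑-cong f≈g xs)

  ∑-++ : ∀ {A : Set} (f : A → Carrier) xs ys → ∑ (xs ++ ys) f ≈ ∑ xs f + ∑ ys f
  ∑-++ f []       ys = sym (+-identityˡ _)
  ∑-++ f (x ∷ xs) ys = trans (+-congˡ (∑-++ f xs ys)) (sym (+-assoc _ _ _))

  ∑-map : ∀ {A B : Set} (g : A → B) (f : B → Carrier) xs →
          ∑ (map g xs) f ≈ ∑ xs (f ∘ g)
  ∑-map g f xs = reflexive (≡.cong (foldr _+_ 0#) (≡.sym (map-∘ xs)))

  ∑-concatMap : ∀ {A B : Set} (g : A → List B) (f : B → Carrier) xs →
                ∑ (concatMap g xs) f ≈ ∑ xs (λ x → ∑ (g x) f)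
  ∑-concatMap g f []       = refl
  ∑-concatMap g f (x ∷ xs) =
    trans (∑-++ f (g x) (concatMap g xs)) (+-congˡ (∑-concatMap g f xs))

  *-distribˡ-∑ : ∀ {A : Set} a (f : A → Carrier) xs →
                 ∑ xs (λ x → a * f x) ≈ a * ∑ xs f
  *-distribˡ-∑ a f []       = sym (zeroʳ a)
  *-distribˡ-∑ a f (x ∷ xs) =
    trans (+-congˡ (*-distribˡ-∑ a f xs)) (sym (distribˡ a _ _))

  *-distribʳ-∑ : ∀ {A : Set} a (f : A → Carrier) xs →
                 ∑ xs (λ x → f x * a) ≈ ∑ xs f * a
  *-distribʳ-∑ a f []       = sym (zeroˡ a)
  *-distribʳ-∑ a f (x ∷ xs) =
    trans (+-congˡ (*-distribʳ-∑ a f xs)) (sym (distribʳ a _ _))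

  sum-cong : ∀ {A : Set} (E : Finite A) {f g : A → Carrier} →
             (∀ x → f x ≈ g x) → sum R E f ≈ sum R E g
  sum-cong E f≈g = ∑-cong f≈g (elements E)

  sum-⊎ : ∀ {A B : Set} (E : Finite A) (F : Finite B) (f : A ⊎ B → Carrier) →
          sum R (finite-⊎ E F) f ≈ sum R E (f ∘ inj₁) + sum R F (f ∘ inj₂)
  sum-⊎ E F f = trans (∑-++ f (map inj₁ (elements E)) (map inj₂ (elements F)))
                      (+-cong (∑-map inj₁ f (elements E)) (∑-map inj₂ f (elements F)))

  sum-Σ : ∀ {A : Set} {B : A → Set} (E : Finite A) (F : ∀ x → Finite (B x))
          (f : Σ[ x ∈ A ] B x → Carrier) →
          sum R (finite-Σ E F) f ≈ sum R E (λ x → sum R (F x) (λ y → f (x , y)))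
  sum-Σ E F f = trans (∑-concatMap (λ x → map (x ,_) (elements (F x))) f (elements E))
                      (sum-cong E λ x → ∑-map (x ,_) f (elements (F x)))

  -- A bijection only reorders the terms, and addition is commutative.
  sum-bijection : ∀ {A B : Set} (E : Finite A) (F : Finite B) {f : A → B} →
                  Injective _≡_ _≡_ f → (∀ y → ∃[ x ] f x ≡ y) →
                  (g : B → Carrier) → sum R F g ≈ sum R E (g ∘ f)
  sum-bijection E F {f} inj surj g =
    trans (PermSetoid.foldr-commMonoid setoid +-isCommutativeMonoid
            (↭⇒↭ₛ′ isEquivalence (Perm.map⁺ g (elements-↭ E F inj surj))))
          (∑-map f g (elements E))

  -- Multiplicativity of weights and summing out the tilings.

  module _ (p q r : Carrier) where
    open Exp semiring using (^-homo-*)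
    open CommutativeSemigroupProperties *-commutativeSemigroup
      using (interchange; x∙yz≈y∙xz)

    private
      wt : Counts → Carrier
      wt = weight R p q r

      Pᴿ : ℕ → Carrier
      Pᴿ = P R p q r

    weight-0 : wt (counts 0 0 0) ≈ 1#
    weight-0 = trans (*-identityʳ _) (*-identityʳ _)

    -- Exponents add, and two uses of `interchange` separate the six powers into the two weights.
    weight-⊕ : ∀ v w → wt (v ⊕ w) ≈ wt v * wt w
    weight-⊕ (counts a b c) (counts a′ b′ c′) =
      trans (*-cong (*-cong (^-homo-* q a a′) (^-homo-* p b b′)) (^-homo-* r c c′))
            (trans (*-congʳ (interchange _ _ _ _)) (interchange _ _ _ _))

    -- The total weight of all ways to tile columns of these uncanceled heights, as `sum-allCounts`
    -- shows.
    ∏P : ∀ {k} → Vec ℕ k → Carrier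
    ∏P []       = 1#
    ∏P (h ∷ hs) = Pᴿ h * ∏P hs

    -- Commutativity moves the factor of the last tiling to the front, its place in the recurrence.
    ∏P-∷ʳ : ∀ {k} (hs : Vec ℕ k) h → ∏P (hs ∷ʳ h) ≈ Pᴿ h * ∏P hs
    ∏P-∷ʳ []        h = refl
    ∏P-∷ʳ (h′ ∷ hs) h = trans (*-congˡ (∏P-∷ʳ hs h)) (x∙yz≈y∙xz _ _ _)

    -- The tilings of different columns are chosen independently and weights multiply, so
    -- distributivity factors the sum column by column.
    sum-allCounts : ∀ {k} (hs : Vec ℕ k) →
                    sum R (finite-All finite-PTiling hs) (wt ∘ allCounts) ≈ ∏P hs
    -- Over no columns there is exactly one family of tilings, the empty one, of weight `1#`.
    sum-allCounts []       = trans (+-identityʳ _) weight-0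
    sum-allCounts (h ∷ hs) = begin
      sum R (finite-All finite-PTiling (h ∷ hs)) (wt ∘ allCounts)
        -- `finite-All` lists the images of pairs of a first tiling and the remaining ones.
        ≈⟨ ∑-map _ (wt ∘ allCounts) (elements (finite-Σ E λ _ → F)) ⟩
      sum R (finite-Σ E λ _ → F) (λ (T , Ts) → wt (pTilingCounts T ⊕ allCounts Ts))
        ≈⟨ sum-Σ E (λ _ → F) _ ⟩
      sum R E (λ T → sum R F λ Ts → wt (pTilingCounts T ⊕ allCounts Ts))
        ≈⟨ sum-cong E (λ T → sum-cong F λ Ts →
             weight-⊕ (pTilingCounts T) (allCounts Ts)) ⟩
      sum R E (λ T → sum R F λ Ts → wt (pTilingCounts T) * wt (allCounts Ts))
        ≈⟨ sum-cong E (λ T → *-distribˡ-∑ (wt (pTilingCounts T)) _ (elements F)) ⟩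
      sum R E (λ T → wt (pTilingCounts T) * sum R F (wt ∘ allCounts))
        ≈⟨ *-distribʳ-∑ _ _ (elements E) ⟩
      Pᴿ h * sum R F (wt ∘ allCounts)
        ≈⟨ *-congˡ (sum-allCounts hs) ⟩
      Pᴿ h * ∏P hs ∎
      where
      E = finite-PTiling h
      F = finite-All finite-PTiling hs

    -- The heights left to tile depend only on the chosen columns, so the tilings can be summed out
    -- for each choice separately.
    rPT-Increasing : ∀ {n} k (b : Vector ℕ n) →
                     rPT R p q r k b ≈
                     sum R (finite-Increasing n k) λ (is , _) → ∏P (uncanceled b is)
    rPT-Increasing {n} k b = begin
      rPT R p q r k b
        ≈⟨ sum-Σ V (λ is → finite-Σ (finite-Linked is) λ _ → All-PTiling is) _ ⟩
      sum R V (λ is → sum R (finite-Σ (finite-Linked is) λ _ → All-PTiling is)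
                            (λ (_ , Ts) → wt (allCounts Ts)))
        ≈⟨ sum-cong V (λ is → sum-Σ (finite-Linked is) (λ _ → All-PTiling is) _) ⟩
      sum R V (λ is → sum R (finite-Linked is) λ _ →
                      sum R (All-PTiling is) (wt ∘ allCounts))
        ≈⟨ sum-cong V (λ is → sum-cong (finite-Linked is) λ _ →
             sum-allCounts (uncanceled b is)) ⟩
      sum R V (λ is → sum R (finite-Linked is) λ _ → ∏P (uncanceled b is))
        -- The inner sum has one term for an increasing choice and none otherwise; keeping it avoids
        -- a case distinction and lets it be repacked here.
        ≈⟨ sum-Σ V finite-Linked _ ⟨
      sum R (finite-Increasing n k) (λ (is , _) → ∏P (uncanceled b is)) ∎
      where
      V = finite-Vec (finite-Fin n) k
      All-PTiling : (is : Vec (Fin n) k) → Finite (All PTiling (uncanceled b is))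
      All-PTiling is = finite-All finite-PTiling (uncanceled b is)

    -- The recurrence.

    ∏P-uncanceled-∷ʳ-fromℕ :
      ∀ {n k} (b : Vector ℕ (suc n)) (is : Vec (Fin n) k) →
      ∏P (uncanceled b (Vec.map inject₁ is ∷ʳ fromℕ n)) ≈
      Pᴿ (b (fromℕ n ⊖ k)) * ∏P (uncanceled (init b) is)
    ∏P-uncanceled-∷ʳ-fromℕ {n} {k} b is = begin
      ∏P (uncanceled b (Vec.map inject₁ is ∷ʳ fromℕ n))
        -- Counted from 0, the last column stands at position `k`, hence the shift by `k`.
        ≡⟨ ≡.cong ∏P (uncanceled-∷ʳ b (Vec.map inject₁ is) (fromℕ n)) ⟩
      ∏P (uncanceled b (Vec.map inject₁ is) ∷ʳ b (fromℕ n ⊖ k))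
        ≈⟨ ∏P-∷ʳ (uncanceled b (Vec.map inject₁ is)) _ ⟩
      Pᴿ (b (fromℕ n ⊖ k)) * ∏P (uncanceled b (Vec.map inject₁ is))
        ≡⟨ ≡.cong (λ hs → Pᴿ (b (fromℕ n ⊖ k)) * ∏P hs) (uncanceled-map-inject₁ b is) ⟩
      Pᴿ (b (fromℕ n ⊖ k)) * ∏P (uncanceled (init b) is) ∎

    rPT-suc : ∀ {n} k (b : Vector ℕ (suc n)) →
              rPT R p q r (suc k) b ≈
              rPT R p q r (suc k) (init b)
                + Pᴿ (b (fromℕ n ⊖ k)) * rPT R p q r k (init b)
    rPT-suc {n} k b = begin
      rPT R p q r (suc k) b
        ≈⟨ rPT-Increasing (suc k) b ⟩
      sum R (finite-Increasing (suc n) (suc k)) (λ (is , _) → ∏P (uncanceled b is))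
        -- Reindexing along `addColumn` splits the sum into the two terms of the recurrence.
        ≈⟨ sum-bijection (finite-⊎ E F) (finite-Increasing (suc n) (suc k))
             addColumn-injective addColumn-surjective _ ⟩
      sum R (finite-⊎ E F) _
        ≈⟨ sum-⊎ E F _ ⟩
      sum R E (λ (is , _) → ∏P (uncanceled b (Vec.map inject₁ is)))
        + sum R F (λ (is , _) → ∏P (uncanceled b (Vec.map inject₁ is ∷ʳ fromℕ n)))
        ≈⟨ +-cong
             (sum-cong E λ (is , _) → reflexive (≡.cong ∏P (uncanceled-map-inject₁ b is)))
             (sum-cong F λ (is , _) → ∏P-uncanceled-∷ʳ-fromℕ b is) ⟩
      sum R E (λ (is , _) → ∏P (uncanceled (init b) is))
        + sum R F (λ (is , _) → Pᴿ (b (fromℕ n ⊖ k)) * ∏P (uncanceled (init b) is))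
        -- The factor of the last column does not depend on the earlier columns and leaves the sum.
        ≈⟨ +-cong (sym (rPT-Increasing (suc k) (init b)))
             (trans (*-distribˡ-∑ _ _ (elements F))
                    (*-congˡ (sym (rPT-Increasing k (init b))))) ⟩
      rPT R p q r (suc k) (init b)
        + Pᴿ (b (fromℕ n ⊖ k)) * rPT R p q r k (init b) ∎
      where
      E = finite-Increasing n (suc k)
      F = finite-Increasing n k

theorem7 : ∀ {c ℓ} (R : CommutativeSemiring c ℓ) → let open CommutativeSemiring R in
    (p q r : Carrier) (n : ℕ) (b : Vector ℕ (suc n)) →
    (∀ {i j : Fin (suc n)} → i ≤ᶠ j → b i ≤ b j) →
    0 < last b →
    (k : ℕ) → 1 ≤ k → k ≤ suc n →
    rPT R p q r k b
    ≈ rPT R p q r k (init b)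
    + P R p q r (b (fromℕ n ⊖ (k ∸ 1))) * rPT R p q r (k ∸ 1) (init b)
-- The bound `1 ≤ k` excludes zero. The index in `rPT-suc` counts the tilings before the last
-- column, which is `k ∸ 1` in the statement.
theorem7 R p q r n b _ _ (suc k) _ _ = rPT-suc R p q r k b
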